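{- Kimberling's infinite word ${\bf B}$ is equal to $0f({\bf TR})$, where ${\bf TR}$ is the infinite Tribonacci word and $f$ is the morphism $f: 0\mapsto 10,\ 1\mapsto 0,\ 2\mapsto 1$. (Here $0f({\bf TR})$ is the letter $0$ followed by the infinite word $f({\bf TR})$.)
   Context: Definition of ${\bf B}$: Let $B_0=00$. Given a binary word $B_i$, factor it into blocks: each letter $1$ is a block by itself, and each maximal run of consecutive $0$'s is a block, which is either $0$ or $00$ (runs of three or more $0$'s never occur). Then $B_{i+1}$ is obtained by replacing each block $0$ by $0$, each block $1$ by $10$, and each block $00$ by $0101$. For example $B_1=0101$, $B_2=010010$, $B_3=0100101100$. For $i\ge 2$, $B_i$ is a prefix of $B_{i+1}$, and ${\bf B}=0100101100\cdots$ is the unique infinite word having all $B_i$, $i\ge 2$, as prefixes. The Tribonacci word ${\bf TR}=0102010010201\cdots$ is the infinite fixed point (starting with $0$) of the morphism $0\mapsto 01$, $1\mapsto 02$, $2\mapsto 0$. -}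

module Defs where

open import Data.Fin.Base using (Fin)
open import Data.Fin.Patterns
open import Data.List.Base using (List; []; _∷_; _++_; length; applyUpTo; concatMap)
open import Data.List.NonEmpty.Base using (List⁺; _∷_; toList)
open import Data.List.Properties
  using (length-++; concatMap-++; ∷-injective; ∷-injectiveˡ; ∷-injectiveʳ)
open import Data.Nat.Base using (ℕ; zero; suc; _+_; _≤_; _<_; z≤n; s≤s)
open import Data.Nat.Properties using (≤-trans; m≤m+n; +-suc)
open import Data.Product using (∃; ∃!; ∃₂; _×_; _,_; proj₁)
open import Function.Base using (_∘_)
open import Relation.Binary.PropositionalEquality
  using (_≡_; _≗_; refl; sym; trans; cong; cong₂)
open import Relation.Nullary using (¬_)

private
  variable
    A C : Set

-- Infinite words are compared pointwise, with _≗_.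
Word : Set → Set
Word A = ℕ → A

infixr 5 _◂_ _++ω_
infix 4 _≺_
infix 9 _⟨_⟩

_◂_ : A → Word A → Word A
(a ◂ w) zero    = a
(a ◂ w) (suc n) = w n

_++ω_ : List A → Word A → Word A
[]      ++ω w = w
(a ∷ u) ++ω w = a ◂ (u ++ω w)

-- The finite word u is a prefix of w.
_≺_ : List A → Word A → Set
u ≺ w = applyUpTo w (length u) ≡ u

-- expand u W is u · W 0 · W 1 · W 2 ⋯
expand : List⁺ A → Word (List⁺ A) → Word A
expand (a ∷ u)     W zero    = a
expand (a ∷ [])    W (suc n) = expand (W 0) (W ∘ suc) n
expand (a ∷ b ∷ u) W (suc n) = expand (b ∷ u) W n

concatω : Word (List⁺ A) → Word A
concatω W = expand (W 0) (W ∘ suc)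

-- Images of letters are non-empty, so that h ⟨ w ⟩ below is always infinite.
Morphism : Set → Set → Set
Morphism A C = A → List⁺ C

_⟨_⟩ : Morphism A C → Word A → Word C
h ⟨ w ⟩ = concatω (h ∘ w)

_* : Morphism A C → List A → List C
h * = concatMap (toList ∘ h)

expand-≗ : (u : List⁺ A) (W : Word (List⁺ A)) → expand u W ≗ toList u ++ω concatω W
expand-≗ (a ∷ u)     W zero    = refl
expand-≗ (a ∷ [])    W (suc n) = refl
expand-≗ (a ∷ b ∷ u) W (suc n) = expand-≗ (b ∷ u) W n

concatω-≗ : (W : Word (List⁺ A)) → concatω W ≗ toList (W 0) ++ω concatω (W ∘ suc)
concatω-≗ W = expand-≗ (W 0) (W ∘ suc)

applyUpTo-cong : {v w : Word A} → v ≗ w → ∀ n → applyUpTo v n ≡ applyUpTo w n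
applyUpTo-cong v≗w zero    = refl
applyUpTo-cong v≗w (suc n) = cong₂ _∷_ (v≗w 0) (applyUpTo-cong (v≗w ∘ suc) n)

≺-resp-≗ : {v w : Word A} → v ≗ w → ∀ u → u ≺ v → u ≺ w
≺-resp-≗ v≗w u p = trans (sym (applyUpTo-cong v≗w (length u))) p

++ω-cong : (u : List A) {v w : Word A} → v ≗ w → u ++ω v ≗ u ++ω w
++ω-cong []      v≗w n       = v≗w n
++ω-cong (a ∷ u) v≗w zero    = refl
++ω-cong (a ∷ u) v≗w (suc n) = ++ω-cong u v≗w n

++ω-assoc : (u v : List A) (w : Word A) → (u ++ v) ++ω w ≗ u ++ω (v ++ω w)
++ω-assoc []      v w n       = refl
++ω-assoc (a ∷ u) v w zero    = refl
++ω-assoc (a ∷ u) v w (suc n) = ++ω-assoc u v w n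

≺-++ω : (u : List A) (w : Word A) → u ≺ u ++ω w
≺-++ω []      w = refl
≺-++ω (a ∷ u) w = cong (a ∷_) (≺-++ω u w)

++-≺-++ω : (u : List A) {v : List A} {w : Word A} → v ≺ w → u ++ v ≺ u ++ω w
++-≺-++ω []      p = p
++-≺-++ω (a ∷ u) p = cong (a ∷_) (++-≺-++ω u p)

≺-morphism : (h : Morphism A C) (u : List A) (w : Word A) → u ≺ w → (h *) u ≺ h ⟨ w ⟩
≺-morphism h []      w p = refl
≺-morphism h (a ∷ u) w p with refl , q ← ∷-injective p =
  ≺-resp-≗ (sym ∘ concatω-≗ (h ∘ w)) (toList (h a) ++ (h *) u)
    (++-≺-++ω (toList (h a)) (≺-morphism h u (w ∘ suc) q))

≺-agree : (n m : ℕ) {v w : Word A} → n < m → applyUpTo v m ≡ applyUpTo w m → v n ≡ w n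
≺-agree zero    (suc m) n<m       p = ∷-injectiveˡ p
≺-agree (suc n) (suc m) (s≤s n<m) p = ≺-agree n m n<m (∷-injectiveʳ p)

-- A chain of finite words, each a proper prefix of the next, has a unique limit.
module Limit (W : ℕ → List A)
             (ext : ∀ i → ∃₂ λ a u → W (suc i) ≡ W i ++ a ∷ u) where

  chain : (V : ℕ → List A) (D : Word (List⁺ A)) →
          (∀ i → V (suc i) ≡ V i ++ toList (D i)) → ∀ i → V i ≺ V 0 ++ω concatω D
  chain V D eq zero    = ≺-++ω (V 0) (concatω D)
  chain V D eq (suc i) = ≺-resp-≗ step-≗ (V (suc i)) (chain (V ∘ suc) (D ∘ suc) (eq ∘ suc) i)
    where
    step-≗ : V 1 ++ω concatω (D ∘ suc) ≗ V 0 ++ω concatω D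
    step-≗ n rewrite eq 0 =
      trans (++ω-assoc (V 0) (toList (D 0)) (concatω (D ∘ suc)) n)
            (sym (++ω-cong (V 0) (concatω-≗ D) n))

  new : Word (List⁺ A)
  new i = let a , u , _ = ext i in a ∷ u

  limit : Word A
  limit = W 0 ++ω concatω new

  limit-≺ : ∀ i → W i ≺ limit
  limit-≺ = chain W new (λ i → let _ , _ , eq = ext i in eq)

  i≤length : ∀ i → i ≤ length (W i)
  i≤length zero = z≤n
  i≤length (suc i) with a , u , eq ← ext i rewrite eq | length-++ (W i) {a ∷ u} | +-suc (length (W i)) (length u) =
    s≤s (≤-trans (i≤length i) (m≤m+n _ _))

  unique : {v w : Word A} → (∀ i → W i ≺ v) → (∀ i → W i ≺ w) → v ≗ w
  unique p q n =
    ≺-agree n (length (W (suc n))) (i≤length (suc n)) (trans (p (suc n)) (sym (q (suc n))))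

data Block : Set where
  [0] [1] [00] : Block

-- On words without 000 (see no-000 below) the blocks of zeros produced here are
-- exactly the maximal runs of zeros.
blocks : List (Fin 2) → List Block
blocks []            = []
blocks (1F ∷ w)      = [1] ∷ blocks w
blocks (0F ∷ [])     = [0] ∷ []
blocks (0F ∷ 0F ∷ w) = [00] ∷ blocks w
blocks (0F ∷ 1F ∷ w) = [0] ∷ [1] ∷ blocks w

replace : Block → List (Fin 2)
replace [0]  = 0F ∷ []
replace [1]  = 1F ∷ 0F ∷ []
replace [00] = 0F ∷ 1F ∷ 0F ∷ 1F ∷ []

next : List (Fin 2) → List (Fin 2)
next w = concatMap replace (blocks w)

B : ℕ → List (Fin 2)
B zero    = 0F ∷ 0F ∷ []
B (suc i) = next (B i)

_ : B 1 ≡ 0F ∷ 1F ∷ 0F ∷ 1F ∷ []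
_ = refl

_ : B 2 ≡ 0F ∷ 1F ∷ 0F ∷ 0F ∷ 1F ∷ 0F ∷ []
_ = refl

_ : B 3 ≡ 0F ∷ 1F ∷ 0F ∷ 0F ∷ 1F ∷ 0F ∷ 1F ∷ 1F ∷ 0F ∷ 0F ∷ []
_ = refl

No000 : List (Fin 2) → Set
No000 w = ∀ u v → ¬ (w ≡ u ++ 0F ∷ 0F ∷ 0F ∷ v)

No00Start : List (Fin 2) → Set
No00Start w = ∀ v → ¬ (w ≡ 0F ∷ 0F ∷ v)

1∷-No000 : ∀ {w} → No000 w → No000 (1F ∷ w)
1∷-No000 p (_ ∷ u) v eq = p u v (∷-injectiveʳ eq)

0∷-No000 : ∀ {w} → No00Start w → No000 w → No000 (0F ∷ w)
0∷-No000 s p []      v eq = s v (∷-injectiveʳ eq)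
0∷-No000 s p (_ ∷ u) v eq = p u v (∷-injectiveʳ eq)

next-No00Start : ∀ w → No00Start (next w)
next-No00Start []            v ()
next-No00Start (1F ∷ w)      v ()
next-No00Start (0F ∷ [])     v ()
next-No00Start (0F ∷ 0F ∷ w) v ()
next-No00Start (0F ∷ 1F ∷ w) v ()

next-No000 : ∀ w → No000 (next w)
next-No000 []            []          v ()
next-No000 []            (_ ∷ _)     v ()
next-No000 (1F ∷ w)      = 1∷-No000 (0∷-No000 (next-No00Start w) (next-No000 w))
next-No000 (0F ∷ [])     = 0∷-No000 (λ _ ()) (next-No000 [])
next-No000 (0F ∷ 0F ∷ w) =
  0∷-No000 (λ _ ()) (1∷-No000 (0∷-No000 (λ _ ()) (1∷-No000 (next-No000 w))))
next-No000 (0F ∷ 1F ∷ w) =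
  0∷-No000 (λ _ ()) (1∷-No000 (0∷-No000 (next-No00Start w) (next-No000 w)))

no-000 : ∀ i → No000 (B i)
no-000 zero    = 0∷-No000 (λ _ ()) (0∷-No000 (λ _ ()) (next-No000 []))
no-000 (suc i) = next-No000 (B i)

next-++ : ∀ u v → next (u ++ 1F ∷ v) ≡ next u ++ next (1F ∷ v)
next-++ []            v = refl
next-++ (1F ∷ u)      v = cong (λ z → 1F ∷ 0F ∷ z) (next-++ u v)
next-++ (0F ∷ [])     v = refl
next-++ (0F ∷ 0F ∷ u) v = cong (λ z → 0F ∷ 1F ∷ 0F ∷ 1F ∷ z) (next-++ u v)
next-++ (0F ∷ 1F ∷ u) v = cong (λ z → 0F ∷ 1F ∷ 0F ∷ z) (next-++ u v)

B-ext′ : ∀ i → ∃ λ v → B (3 + i) ≡ B (2 + i) ++ 1F ∷ v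
B-ext′ zero = _ , refl
B-ext′ (suc i) with v , eq ← B-ext′ i =
  _ , trans (cong next eq) (next-++ (B (2 + i)) v)

B-ext : ∀ i → ∃₂ λ a v → B (3 + i) ≡ B (2 + i) ++ a ∷ v
B-ext i = 1F , B-ext′ i

kimberling : ∃! _≗_ λ (w : Word (Fin 2)) → ∀ i → 2 ≤ i → B i ≺ w
kimberling = limit , (λ { _ (s≤s (s≤s {n = i} z≤n)) → limit-≺ i }) ,
             (λ p → unique limit-≺ (λ i → p (2 + i) (s≤s (s≤s z≤n))))
  where open Limit (λ i → B (2 + i)) B-ext

𝐁 : Word (Fin 2)
𝐁 = proj₁ kimberling

τ : Morphism (Fin 3) (Fin 3)
τ 0F = 0F ∷ 1F ∷ []
τ 1F = 0F ∷ 2F ∷ []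
τ 2F = 0F ∷ []

T : ℕ → List (Fin 3)
T zero    = 0F ∷ []
T (suc i) = (τ *) (T i)

T-ext : ∀ i → ∃₂ λ a v → T (suc i) ≡ T i ++ a ∷ v
T-ext zero    = 1F , [] , refl
T-ext (suc i) with a , v , eq ← T-ext i with τ a in e
... | b ∷ u = b , u ++ (τ *) v ,
  trans (cong (τ *) eq) (trans (concatMap-++ (toList ∘ τ) (T i) (a ∷ v))
    (cong (λ z → T (suc i) ++ toList z ++ (τ *) v) e))

tribonacci : ∃! _≗_ λ (w : Word (Fin 3)) → w 0 ≡ 0F × τ ⟨ w ⟩ ≗ w
tribonacci = limit , (refl , fixed) , λ (w0 , fix) → unique limit-≺ (T-≺ w0 fix)
  where
  open Limit T T-ext

  image-≺ : ∀ i → T i ≺ τ ⟨ limit ⟩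
  image-≺ zero    = refl
  image-≺ (suc i) = ≺-morphism τ (T i) limit (limit-≺ i)

  fixed : τ ⟨ limit ⟩ ≗ limit
  fixed = unique image-≺ limit-≺

  T-≺ : ∀ {w} → w 0 ≡ 0F → τ ⟨ w ⟩ ≗ w → ∀ i → T i ≺ w
  T-≺ w0 fix zero    = cong (_∷ []) w0
  T-≺ w0 fix (suc i) = ≺-resp-≗ fix (T (suc i)) (≺-morphism τ (T i) _ (T-≺ w0 fix i))

TR : Word (Fin 3)
TR = proj₁ tribonacci

_ : applyUpTo TR 13 ≡
    0F ∷ 1F ∷ 0F ∷ 2F ∷ 0F ∷ 1F ∷ 0F ∷ 0F ∷ 1F ∷ 0F ∷ 2F ∷ 0F ∷ 1F ∷ []
_ = refl

f : Morphism (Fin 3) (Fin 2)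
f 0F = 1F ∷ 0F ∷ []
f 1F = 0F ∷ []
f 2F = 1F ∷ []

{-# OPTIONS --safe #-}
-- The morphism f intertwines Kimberling's rule with τ: next (0 · f (τ u)) = 0 · f (τ (τ u)).
-- As B₂ = 0 · f (010) and 010 = τ (02), every B i with i ≥ 2 is 0 · f (τⁱ⁻² (010)), and
-- τⁱ⁻² (010) is a prefix of TR because 010 is.
module Submission where

open import Data.Fin.Base using (Fin)
open import Data.Fin.Patterns using (0F; 1F; 2F)
open import Data.List.Base using (List; []; _∷_)
open import Data.Nat.Base using (ℕ; zero; suc; _+_; s≤s; z≤n)
open import Data.Product using (_,_)
open import Relation.Binary.PropositionalEquality
  using (_≡_; _≗_; refl; trans; cong)
open import Defs

-- Non-empty images under f ∘ τ start with 1, so the leading 0 is a block by itself.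
next-0∷f*τ* : ∀ u → next (0F ∷ (f *) ((τ *) u)) ≡ 0F ∷ next ((f *) ((τ *) u))
next-0∷f*τ* []       = refl
next-0∷f*τ* (0F ∷ u) = refl
next-0∷f*τ* (1F ∷ u) = refl
next-0∷f*τ* (2F ∷ u) = refl

-- By letters: f (τ a) is 100, 101 or 10, always starting with 1, so no block crosses into the next
-- image.
next-f*τ* : ∀ u → next ((f *) ((τ *) u)) ≡ (f *) ((τ *) ((τ *) u))
next-f*τ* []       = refl
next-f*τ* (0F ∷ u) = cong (λ z → 1F ∷ 0F ∷ 0F ∷ 1F ∷ 0F ∷ 1F ∷ z) (next-f*τ* u)
next-f*τ* (1F ∷ u) = cong (λ z → 1F ∷ 0F ∷ 0F ∷ 1F ∷ 0F ∷ z) (next-f*τ* u)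
-- The final 0 of f (τ 2) = 10 leaves `blocks` stuck until the rest is inspected.
next-f*τ* (2F ∷ u) = trans (cong (λ z → 1F ∷ 0F ∷ z) (next-0∷f*τ* u))
                           (cong (λ z → 1F ∷ 0F ∷ 0F ∷ z) (next-f*τ* u))

-- Starting at 02, not a prefix of `TR`, makes every later word a τ-image by definition, as the
-- lemmas above require.
τ^_⟨02⟩ : ℕ → List (Fin 3)
τ^ zero  ⟨02⟩ = 0F ∷ 2F ∷ []
τ^ suc i ⟨02⟩ = (τ *) τ^ i ⟨02⟩

B≡0∷f*τ^⟨02⟩ : ∀ i → B (2 + i) ≡ 0F ∷ (f *) τ^ suc i ⟨02⟩
B≡0∷f*τ^⟨02⟩ zero    = refl
B≡0∷f*τ^⟨02⟩ (suc i) = trans (cong next (B≡0∷f*τ^⟨02⟩ i))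
  (trans (next-0∷f*τ* τ^ i ⟨02⟩) (cong (0F ∷_) (next-f*τ* τ^ i ⟨02⟩)))

τ^⟨02⟩-≺-TR : ∀ i → τ^ suc i ⟨02⟩ ≺ TR
τ^⟨02⟩-≺-TR zero    = refl
τ^⟨02⟩-≺-TR (suc i) = let _ , (_ , fixed) , _ = tribonacci in
  ≺-resp-≗ fixed τ^ suc (suc i) ⟨02⟩ (≺-morphism τ τ^ suc i ⟨02⟩ TR (τ^⟨02⟩-≺-TR i))

theorem2 : 𝐁 ≗ 0F ◂ f ⟨ TR ⟩
theorem2 = let _ , _ , unique = kimberling in
  -- `𝐁` is the only word with every `B i`, i ≥ 2, as a prefix.
  unique λ { _ (s≤s (s≤s {n = i} z≤n)) → B-≺ i }
  where
  B-≺ : ∀ i → B (2 + i) ≺ 0F ◂ f ⟨ TR ⟩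
  B-≺ i rewrite B≡0∷f*τ^⟨02⟩ i =
    cong (0F ∷_) (≺-morphism f τ^ suc i ⟨02⟩ TR (τ^⟨02⟩-≺-TR i))
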